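{- Let $k\ge 3$ be an integer. Then $2\le \chi(k^2,k)\le 3$.
   Context: For positive integers $k,N,d$ with $k\ge 3$, a $k$-term cyclic arithmetic progression mod $N$ with common difference $d$ is a $k$-element subset of $\mathbb{Z}_N=\mathbb{Z}/N\mathbb{Z}$ of the form $\{t,t+d,\ldots,t+(k-1)d\}$ for some $t\in\mathbb{Z}_N$ (so these $k$ elements are pairwise distinct mod $N$). $\chi(N,k)$ denotes the minimum number of subsets necessary to partition $\mathbb{Z}_N$ such that no subset in the partition contains any $k$-term cyclic arithmetic progression mod $N$. -}

module Defs where

open import Data.Fin using (Fin; zero; suc; toℕ; _≟_)
open import Data.Fin.Properties using (nonZeroIndex; toℕ-fromℕ<; toℕ-injective; any?; all?)
open import Data.Fin.Subset using (Subset; Nonempty; _∈_; ⁅_⁆)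
open import Data.Fin.Subset.Properties using (nonempty?; _∈?_; anySubset?; x∈⁅x⁆; x∈⁅y⁆⇒x≡y)
open import Data.Nat using (ℕ; zero; suc; _+_; _*_; _≤_; _>_; z≤n; s≤s; NonZero; >-nonZero⁻¹)
open import Data.Nat.DivMod using (_%_; _/_; _mod_; m≡m%n+[m/n]*n; [m+kn]%n≡m%n)
open import Data.Nat.Properties using (≤-trans; m≤n+m; +-assoc; *-assoc; *-distribˡ-+)
open import Data.Product using (∃; _×_; _,_; proj₁; proj₂)
open import Data.Vec using (Vec; []; _∷_; lookup; tabulate)
open import Data.Vec.Properties using (lookup∘tabulate)
open import Function using (_∘_)
open import Function.Definitions using (Injective)
open import Relation.Binary.PropositionalEquality
open import Relation.Nullary using (¬_; Dec; yes; no)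
open import Relation.Nullary.Decidable using (map′; _×-dec_; _→-dec_; ¬?)
open import Relation.Nullary.Negation using (contradiction)
open import Relation.Unary using (Decidable)

-- ℤ/Nℤ is represented by Fin N; term t d i is the residue class of t + i d.

term : ∀ {N} → Fin N → ℕ → ℕ → Fin N
term {N} t d i = _mod_ (toℕ t + i * d) N {{nonZeroIndex t}}

-- The field distinct says that {t, t + d, …, t + (k-1)d} has k elements.

record CyclicAP (N k : ℕ) : Set where
  field
    start    : Fin N
    diff     : ℕ
    diff>0   : diff > 0
    distinct : Injective {A = Fin k} _≡_ _≡_ (λ i → term start diff (toℕ i))

  element : Fin k → Fin N
  element i = term start diff (toℕ i)

Contains : ∀ {N k} → Subset N → CyclicAP N k → Set
Contains S P = ∀ i → CyclicAP.element P i ∈ S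

APFree : ∀ {N} → ℕ → Subset N → Set
APFree {N} k S = ¬ ∃ λ (P : CyclicAP N k) → Contains S P

record IsPartition {N m : ℕ} (parts : Vec (Subset N) m) : Set where
  field
    nonempty : ∀ j → Nonempty (lookup parts j)
    cover    : ∀ x → ∃ λ j → x ∈ lookup parts j
    disjoint : ∀ i j x → x ∈ lookup parts i → x ∈ lookup parts j → i ≡ j

APFreePartition : ℕ → ℕ → ℕ → Set
APFreePartition N k m =
  ∃ λ (parts : Vec (Subset N) m) → IsPartition parts × (∀ j → APFree k (lookup parts j))

IsLeast : (ℕ → Set) → ℕ → Set
IsLeast P m = P m × (∀ n → P n → m ≤ n)

-- The minimum defining χ exists: a set of admissible sizes is decidable, and
-- the partition into singletons is admissible.

least : {P : ℕ → Set} → Decidable P → ∃ P → ∃ (IsLeast P)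
least {P} P? (n , pn) = go P? n pn
  where
  go : {Q : ℕ → Set} → Decidable Q → ∀ n → Q n → ∃ (IsLeast Q)
  go Q? n qn with Q? 0
  go Q? n       qn | yes q0 = 0 , q0 , λ _ _ → z≤n
  go Q? zero    qn | no ¬q0 = contradiction qn ¬q0
  go Q? (suc n) qn | no ¬q0 with go (Q? ∘ suc) n qn
  ... | m , qm , m≤ = suc m , qm ,
    λ { zero q0 → contradiction q0 ¬q0 ; (suc l) ql → s≤s (m≤ l ql) }

anyVec? : ∀ {N m} {P : Vec (Subset N) m → Set} → Decidable P → Dec (∃ P)
anyVec? {m = zero}  P? = map′ ([] ,_) (λ { ([] , p) → p }) (P? [])
anyVec? {m = suc m} P? =
  map′ (λ { (S , Ss , p) → (S ∷ Ss) , p }) (λ { ((S ∷ Ss) , p) → S , Ss , p })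
       (anySubset? λ S → anyVec? λ Ss → P? (S ∷ Ss))

isPartition? : ∀ {N m} → Decidable (IsPartition {N} {m})
isPartition? parts =
  map′ (λ { (n , c , d) → record { nonempty = n ; cover = c ; disjoint = d } })
       (λ p → let open IsPartition p in nonempty , cover , disjoint)
       (all? (λ j → nonempty? (lookup parts j))
        ×-dec all? (λ x → any? λ j → x ∈? lookup parts j)
        ×-dec all? λ i → all? λ j → all? λ x →
          (x ∈? lookup parts i) →-dec ((x ∈? lookup parts j) →-dec (i ≟ j)))

-- Every common difference may be replaced by one in {N, …, 2N - 1}.

term-reduce : ∀ {N} (t : Fin N) d i →
              term t (toℕ (_mod_ d N {{nonZeroIndex t}}) + N) i ≡ term t d i
term-reduce {N} t d i = toℕ-injective (begin
  toℕ (term t (toℕ (d mod N) + N) i)  ≡⟨ toℕ-fromℕ< _ ⟩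
  (a + i * (toℕ (d mod N) + N)) % N   ≡⟨ cong (λ r → (a + i * (r + N)) % N) (toℕ-fromℕ< _) ⟩
  (a + i * (r + N)) % N               ≡⟨ cong (λ z → (a + z) % N) (*-distribˡ-+ i r N) ⟩
  (a + (i * r + i * N)) % N           ≡⟨ cong (_% N) (+-assoc a (i * r) (i * N)) ⟨
  (a + i * r + i * N) % N             ≡⟨ [m+kn]%n≡m%n (a + i * r) i N ⟩
  (a + i * r) % N                     ≡⟨ [m+kn]%n≡m%n (a + i * r) (i * (d / N)) N ⟨
  (a + i * r + i * (d / N) * N) % N   ≡⟨ cong (_% N) (+-assoc a (i * r) _) ⟩
  (a + (i * r + i * (d / N) * N)) % N ≡⟨ cong (λ z → (a + (i * r + z)) % N) (*-assoc i (d / N) N) ⟩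
  (a + (i * r + i * (d / N * N))) % N ≡⟨ cong (λ z → (a + z) % N) (*-distribˡ-+ i r (d / N * N)) ⟨
  (a + i * (r + d / N * N)) % N       ≡⟨ cong (λ z → (a + i * z) % N) (m≡m%n+[m/n]*n d N) ⟨
  (a + i * d) % N                     ≡⟨ toℕ-fromℕ< _ ⟨
  toℕ (term t d i)                    ∎)
  where
  open ≡-Reasoning
  instance
    _ : NonZero N
    _ = nonZeroIndex t
  a r : ℕ
  a = toℕ t
  r = d % N

injective? : ∀ {k N} (f : Fin k → Fin N) → Dec (Injective _≡_ _≡_ f)
injective? f =
  map′ (λ h {i} {j} → h i j) (λ h i j → h {i} {j})
       (all? λ i → all? λ j → (f i ≟ f j) →-dec (i ≟ j))

apFree? : ∀ {N} k → Decidable (APFree {N} k)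
apFree? {N} k S = ¬? (map′ to from
  (any? λ t → any? λ e →
    injective? (step t e) ×-dec all? (λ i → step t e i ∈? S)))
  where
  step : Fin N → Fin N → Fin k → Fin N
  step t e i = term t (toℕ e + N) (toℕ i)

  Bounded : Set
  Bounded = ∃ λ t → ∃ λ e → Injective _≡_ _≡_ (step t e) × (∀ i → step t e i ∈ S)

  to : Bounded → ∃ λ (P : CyclicAP N k) → Contains S P
  to (t , e , inj , mem) =
    record { start = t ; diff = toℕ e + N
           ; diff>0 = ≤-trans (>-nonZero⁻¹ N {{nonZeroIndex t}}) (m≤n+m N (toℕ e))
           ; distinct = inj } , mem

  from : (∃ λ (P : CyclicAP N k) → Contains S P) → Bounded
  from (P , mem) = start , _mod_ diff N {{nonZeroIndex start}} ,
    (λ {i} {j} eq → distinct (trans (sym (red i)) (trans eq (red j)))) ,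
    λ i → subst (_∈ S) (sym (red i)) (mem i)
    where
    open CyclicAP P
    red : ∀ i → step start (_mod_ diff N {{nonZeroIndex start}}) i ≡ element i
    red i = term-reduce start diff (toℕ i)

apFreePartition? : ∀ N k → Decidable (APFreePartition N k)
apFreePartition? N k m =
  anyVec? λ parts → isPartition? parts ×-dec all? λ j → apFree? k (lookup parts j)

singletons : ∀ N k → 3 ≤ k → APFreePartition N k N
singletons N (suc (suc k)) _ = parts , partition , free
  where
  parts : Vec (Subset N) N
  parts = tabulate ⁅_⁆

  self : ∀ x → x ∈ lookup parts x
  self x = subst (x ∈_) (sym (lookup∘tabulate ⁅_⁆ x)) (x∈⁅x⁆ x)

  only : ∀ {j x} → x ∈ lookup parts j → x ≡ j
  only {j} {x} x∈ = x∈⁅y⁆⇒x≡y j (subst (x ∈_) (lookup∘tabulate ⁅_⁆ j) x∈)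

  partition : IsPartition parts
  partition = record
    { nonempty = λ j → j , self j
    ; cover    = λ x → x , self x
    ; disjoint = λ i j x x∈i x∈j → trans (sym (only x∈i)) (only x∈j) }

  free : ∀ j → APFree (suc (suc k)) (lookup parts j)
  free j (P , mem) with CyclicAP.distinct P {zero} {suc zero}
                          (trans (only (mem zero)) (sym (only (mem (suc zero)))))
  ... | ()
singletons N (suc zero) (s≤s ())

χ-exists : ∀ N k → 3 ≤ k → ∃ (IsLeast (APFreePartition N k))
χ-exists N k k≥3 = least (apFreePartition? N k) (N , singletons N k k≥3)

χ : (N k : ℕ) → 3 ≤ k → ℕ
χ N k k≥3 = proj₁ (χ-exists N k k≥3)

χ-isLeast : ∀ N k (k≥3 : 3 ≤ k) → IsLeast (APFreePartition N k) (χ N k k≥3)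
χ-isLeast N k k≥3 = proj₂ (χ-exists N k k≥3)

{-# OPTIONS --safe #-}
module Submission where

open import Data.Empty using (⊥)
open import Data.Fin using (Fin; zero; suc; toℕ; fromℕ<; _≟_)
open import Data.Fin.Properties using (any?; toℕ-injective; toℕ-fromℕ<; toℕ<n; fromℕ<-injective; injective⇒≤; nonZeroIndex)
open import Data.Fin.Subset using (Subset; _∈_)
open import Data.Nat using (ℕ; zero; suc; pred; _+_; _*_; _∸_; _^_; _≤_; _<_; _≤?_; _<?_; z≤n; s≤s; z<s; NonZero; >-nonZero; ⌊_/2⌋; ⌈_/2⌉)
open import Data.Nat.DivMod
open import Data.Nat.Divisibility using (m∣m*n)
open import Data.Nat.Properties hiding (_≤?_; _<?_) renaming (_≟_ to _ℕ≟_)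
open import Data.Nat.Tactic.RingSolver using (solve-∀)
open import Data.Product using (∃; _×_; _,_; proj₁; proj₂)
open import Data.Sum using (_⊎_; inj₁; inj₂)
open import Data.Vec using (lookup; tabulate)
open import Data.Vec.Properties using (lookup∘tabulate; lookup⇒[]=; []=⇒lookup)
open import Function using (_∘_)
open import Function.Definitions using (Injective)
open import Relation.Binary.PropositionalEquality
open import Relation.Nullary using (¬_; yes; no; does; contradiction)
open import Relation.Nullary.Decidable using (dec-true)
open import Defs

-- Let h = ⌈k/2⌉.  Colour x ∈ {0, …, k² - 1} with colour 0 if 0 < x < k, with
-- colour 1 if k ≤ x and x mod k < h, and with colour 2 otherwise, that is, if
-- x = 0 or k ≤ x and h ≤ x mod k.  Colour 0 has fewer than k elements.  The
-- residues mod k of a k-term progression with difference d depend only on the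
-- index mod k, so the index may be taken to range over all of ℕ.  If k ∤ d,
-- one of d, -d has a residue in (0, k/2], and walking with that step one can
-- jump over neither [0, h) nor [h, k): both intervals are met.  If k ∣ d, the
-- quotients by k are distinct, so one of them is 0.  A progression in colour 2
-- through 0 is impossible too: d, -d and 2d would all have residues ≥ h, while
-- the first two of these conditions force d ≡ k/2 and 2d ≡ 0.

-- Pigeonhole counting, and partitions given by classes

injective-below : ∀ {k m} (f : Fin k → ℕ) → (∀ i → f i < m) → Injective _≡_ _≡_ f → k ≤ m
injective-below f f<m f-inj =
  injective⇒≤ {f = λ i → fromℕ< (f<m i)} (f-inj ∘ fromℕ<-injective _ _ (f<m _) (f<m _))

-- Subtracting 1 squeezes the `k` values into `k - 1` places. This serves both for the elements of
-- colour 0 and for the quotients when `k` divides the difference.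
no-injection : ∀ {k} .{{_ : NonZero k}} (f : Fin k → ℕ) →
               (∀ i → 0 < f i) → (∀ i → f i < k) → ¬ Injective _≡_ _≡_ f
no-injection {suc k} f f>0 f<k f-inj =
  1+n≰n (injective-below (pred ∘ f) (λ i → pred-mono-< {{>-nonZero (f>0 i)}} (f<k i))
    (λ {i} {j} eq → f-inj (pred-injective {{>-nonZero (f>0 i)}} {{>-nonZero (f>0 j)}} eq)))

-- `Class` is not assumed decidable: the parts are cut out by the colour that `classify` returns,
-- and `unique` identifies it with any `c` such that `Class c x`.
classesPartition : ∀ {N m k} (Class : Fin m → Fin N → Set) →
  (∀ x → ∃ λ c → Class c x) →
  (∀ {c c′ x} → Class c x → Class c′ x → c ≡ c′) →
  (∀ c → ∃ (Class c)) →
  (∀ c (P : CyclicAP N k) → ¬ (∀ i → Class c (CyclicAP.element P i))) →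
  APFreePartition N k m
classesPartition {N} {m} Class classify unique inhabited free =
  tabulate part ,
  record
    { nonempty = λ c → proj₁ (inhabited c) , into (proj₂ (inhabited c))
    ; cover    = λ x → proj₁ (classify x) , into (proj₂ (classify x))
    ; disjoint = λ i j x x∈i x∈j → unique (out x∈i) (out x∈j) } ,
  λ { c (P , mem) → free c P (out ∘ mem) }
  where
  colour : Fin N → Fin m
  colour = proj₁ ∘ classify

  part : Fin m → Subset N
  part c = tabulate (λ x → does (colour x ≟ c))

  entry : ∀ c x → lookup (lookup (tabulate part) c) x ≡ does (colour x ≟ c)
  entry c x = trans (cong (λ S → lookup S x) (lookup∘tabulate part c))
                    (lookup∘tabulate (λ y → does (colour y ≟ c)) x)

  into : ∀ {c x} → Class c x → x ∈ lookup (tabulate part) c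
  into {c} {x} cl = lookup⇒[]= x _
    (trans (entry c x) (dec-true (colour x ≟ c) (unique (proj₂ (classify x)) cl)))

  out : ∀ {c x} → x ∈ lookup (tabulate part) c → Class c x
  out {c} {x} x∈ with colour x ≟ c | trans (sym (entry c x)) ([]=⇒lookup x∈)
  ... | yes refl | _  = proj₂ (classify x)
  ... | no _     | ()

-- Residues along arithmetic progressions

module _ {k : ℕ} .{{_ : NonZero k}} where

  %-+-step : ∀ a n d → (a + suc n * d) % k ≡ ((a + n * d) % k + d % k) % k
  %-+-step a n d = trans (cong (_% k) (regroup a n d)) (%-distribˡ-+ (a + n * d) d k)
    where
    regroup : ∀ a n d → a + suc n * d ≡ a + n * d + d
    regroup = solve-∀

  -- Without a wrap each step raises the residue by at least 1, so after `k` steps it would reach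
  -- `k`.
  ap-wraps : ∀ a d → 0 < d % k → ¬ (∀ n → (a + n * d) % k + d % k < k)
  ap-wraps a d d>0 nowrap = <⇒≱ (m%n<n (a + k * d) k) (climb k)
    where
    climb : ∀ n → n ≤ (a + n * d) % k
    climb zero    = z≤n
    climb (suc n) = begin
      suc n                     ≡⟨ +-comm 1 n ⟩
      n + 1                     ≤⟨ +-mono-≤ (climb n) d>0 ⟩
      (a + n * d) % k + d % k   ≡⟨ m<n⇒m%n≡m (nowrap n) ⟨
      ((a + n * d) % k + d % k) % k ≡⟨ %-+-step a n d ⟨
      (a + suc n * d) % k       ∎
      where open ≤-Reasoning

  -- From a residue below `h`, a step of at most `k - h` cannot wrap.
  ap-meets-upper : ∀ {h} a d → 0 < d % k → d % k + h ≤ k → ¬ (∀ n → (a + n * d) % k < h)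
  ap-meets-upper {h} a d d>0 d+h≤k below = ap-wraps a d d>0 λ n →
    <-≤-trans (+-monoˡ-< (d % k) (below n)) (≤-trans (≤-reflexive (+-comm h _)) d+h≤k)

  -- A wrap lands on `ρ + d % k - k`, which is below `d % k` and hence below `h`; avoiding `[0, h)`
  -- therefore means never wrapping.
  ap-meets-lower : ∀ {h} a d → 0 < d % k → d % k ≤ h → ¬ (∀ n → h ≤ (a + n * d) % k)
  ap-meets-lower {h} a d d>0 d≤h above = ap-wraps a d d>0 nowrap
    where
    nowrap : ∀ n → (a + n * d) % k + d % k < k
    nowrap n with (a + n * d) % k + d % k <? k
    ... | yes <k = <k
    ... | no ≮k  = contradiction (above (suc n)) (<⇒≱ (begin-strict
      (a + suc n * d) % k           ≡⟨ %-+-step a n d ⟩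
      (ρ + d % k) % k               ≡⟨ m≤n⇒[n∸m]%m≡n%m k≤ ⟨
      (ρ + d % k ∸ k) % k           ≤⟨ m%n≤m _ k ⟩
      ρ + d % k ∸ k                 <⟨ ∸-monoˡ-< (+-monoˡ-< (d % k) (m%n<n (a + n * d) k)) k≤ ⟩
      k + d % k ∸ k                 ≡⟨ m+n∸m≡n k (d % k) ⟩
      d % k                         ≤⟨ d≤h ⟩
      h                             ∎))
      where
      open ≤-Reasoning
      ρ = (a + n * d) % k
      k≤ : k ≤ ρ + d % k
      k≤ = ≮⇒≥ ≮k

  m+n∸k<k : ∀ {m n} → m < k → n < k → k ≤ m + n → m + n ∸ k < k
  m+n∸k<k m<k n<k k≤ = <-≤-trans (∸-monoˡ-< (+-mono-< m<k n<k) k≤) (≤-reflexive (m+n∸m≡n k k))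

  [pred[k]d+d]%k≡0 : ∀ d → (pred k * d + d) % k ≡ 0
  [pred[k]d+d]%k≡0 d = trans (cong (_% k) (trans (+-comm _ d) (trans (cong (_* d) (suc-pred k)) (*-comm k d))))
                         (m*n%n≡0 d k)

  -- `pred k` plays the part of -1. The sum is a multiple of `k` strictly between 0 and `2k`.
  opposite-residue : ∀ d → 0 < d % k → (pred k * d) % k + d % k ≡ k
  opposite-residue d d>0 with (pred k * d) % k + d % k <? k | %-distribˡ-+ (pred k * d) d k
  ... | yes <k | distrib = contradiction
        (trans (sym (m<n⇒m%n≡m <k)) (trans (sym distrib) ([pred[k]d+d]%k≡0 d)))
        (>⇒≢ (<-≤-trans d>0 (m≤n+m (d % k) _)))
  ... | no ≮k | distrib = ≤-antisym (m∸n≡0⇒m≤n excess≡0) k≤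
    where
    k≤ : k ≤ (pred k * d) % k + d % k
    k≤ = ≮⇒≥ ≮k
    excess≡0 : (pred k * d) % k + d % k ∸ k ≡ 0
    excess≡0 = begin
      (pred k * d) % k + d % k ∸ k         ≡⟨ m<n⇒m%n≡m (m+n∸k<k (m%n<n (pred k * d) k) (m%n<n d k) k≤) ⟨
      ((pred k * d) % k + d % k ∸ k) % k   ≡⟨ m≤n⇒[n∸m]%m≡n%m k≤ ⟩
      ((pred k * d) % k + d % k) % k       ≡⟨ distrib ⟨
      (pred k * d + d) % k                 ≡⟨ [pred[k]d+d]%k≡0 d ⟩
      0                                    ∎
      where open ≡-Reasoning

  -- Periodicity in the index lets a progression of only `k` terms be walked indefinitely.
  %-index : ∀ a n d → (a + n % k * d) % k ≡ (a + n * d) % k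
  %-index a n d = sym (begin
    (a + n * d) % k                       ≡⟨ cong (λ z → (a + z * d) % k) (m≡m%n+[m/n]*n n k) ⟩
    (a + (n % k + n / k * k) * d) % k     ≡⟨ cong (_% k) (regroup a (n % k) (n / k) k d) ⟩
    (a + n % k * d + n / k * d * k) % k   ≡⟨ [m+kn]%n≡m%n (a + n % k * d) (n / k * d) k ⟩
    (a + n % k * d) % k                   ∎)
    where
    open ≡-Reasoning
    regroup : ∀ a r q k d → a + (r + q * k) * d ≡ a + r * d + q * d * k
    regroup = solve-∀

  shifted-index : ∀ {j c} → j < k → 0 < c → c < k → ¬ (j + c) % k ≡ j
  shifted-index {j} {c} j<k c>0 c<k eq with j + c <? k
  ... | yes <k = contradiction (trans (sym (m<n⇒m%n≡m <k)) eq) (>⇒≢ (m<m+n j c>0))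
  ... | no ≮k  = contradiction (+-cancelˡ-≡ j c k (begin
    j + c           ≡⟨ m∸n+n≡m k≤ ⟨
    j + c ∸ k + k   ≡⟨ cong (_+ k) (m<n⇒m%n≡m small) ⟨
    (j + c ∸ k) % k + k   ≡⟨ cong (_+ k) (trans (m≤n⇒[n∸m]%m≡n%m k≤) eq) ⟩
    j + k           ∎)) (<⇒≢ c<k)
    where
    open ≡-Reasoning
    k≤ : k ≤ j + c
    k≤ = ≮⇒≥ ≮k
    small : j + c ∸ k < k
    small = m+n∸k<k j<k c<k k≤

-- Progressions in ℤ/k²ℤ

module SquareModulus (k : ℕ) (k≥3 : 3 ≤ k) where

  private instance
    k≢0 : NonZero k
    k≢0 = >-nonZero (<-≤-trans z<s k≥3)

  k^2≡k*k : k ^ 2 ≡ k * k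
  k^2≡k*k = cong (k *_) (*-identityʳ k)

  k<k^2 : k < k ^ 2
  k<k^2 = <-≤-trans (m<m*n k k (<-≤-trans (s≤s (s≤s z≤n)) k≥3)) (≤-reflexive (sym k^2≡k*k))

  -- The three colour classes

  f h : ℕ
  f = ⌊ k /2⌋
  h = ⌈ k /2⌉

  f+h≡k : f + h ≡ k
  f+h≡k = ⌊n/2⌋+⌈n/2⌉≡n k

  f≤h : f ≤ h
  f≤h = ⌊n/2⌋≤⌈n/2⌉ k

  h≤1+f : h ≤ suc f
  -- By definition `h` is the floor of `(k + 1)/2` and `suc f` that of `(k + 2)/2`.
  h≤1+f = ⌊n/2⌋-mono (n≤1+n (suc k))

  h>0 : 0 < h
  h>0 = <-≤-trans z<s (⌈n/2⌉-mono k≥3)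

  h<k : h < k
  h<k = <-≤-trans (m<n+m h (<-≤-trans z<s (⌊n/2⌋-mono k≥3))) (≤-reflexive f+h≡k)

  -- Moving 0 to the last class leaves only `k - 1` elements in the first.
  Class : Fin 3 → ℕ → Set
  Class zero             x = 0 < x × x < k
  Class (suc zero)       x = k ≤ x × x % k < h
  Class (suc (suc zero)) x = x ≡ 0 ⊎ (k ≤ x × h ≤ x % k)

  classify : ∀ x → ∃ λ c → Class c x
  classify zero = suc (suc zero) , inj₁ refl
  classify x@(suc _) with k ≤? x | x % k <? h
  ... | no k≰x  | _      = zero , z<s , ≰⇒> k≰x
  ... | yes k≤x | yes <h = suc zero , k≤x , <h
  ... | yes k≤x | no ≮h  = suc (suc zero) , inj₂ (k≤x , ≮⇒≥ ≮h)

  0-class : ∀ {c} → Class c 0 → suc (suc zero) ≡ c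
  0-class {zero}           (() , _)
  0-class {suc zero}       (k≤0 , _) = contradiction k≤0 (<⇒≱ (<-≤-trans z<s k≥3))
  0-class {suc (suc zero)} _         = refl

  unique : ∀ {c c′ x} → Class c x → Class c′ x → c ≡ c′
  unique {suc (suc zero)} {c′} (inj₁ refl) q = 0-class {c′} q
  unique {c} {suc (suc zero)} p (inj₁ refl) = sym (0-class {c} p)
  unique {zero} {zero} _ _ = refl
  unique {zero} {suc zero} (_ , x<k) (k≤x , _) = contradiction k≤x (<⇒≱ x<k)
  unique {zero} {suc (suc zero)} (_ , x<k) (inj₂ (k≤x , _)) = contradiction k≤x (<⇒≱ x<k)
  unique {suc zero} {zero} (k≤x , _) (_ , x<k) = contradiction k≤x (<⇒≱ x<k)
  unique {suc zero} {suc zero} _ _ = refl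
  unique {suc zero} {suc (suc zero)} (_ , <h) (inj₂ (_ , h≤)) = contradiction h≤ (<⇒≱ <h)
  unique {suc (suc zero)} {zero} (inj₂ (k≤x , _)) (_ , x<k) = contradiction k≤x (<⇒≱ x<k)
  unique {suc (suc zero)} {suc zero} (inj₂ (_ , h≤)) (_ , <h) = contradiction h≤ (<⇒≱ <h)
  unique {suc (suc zero)} {suc (suc zero)} _ _ = refl

  inhabited : ∀ c → ∃ λ x → x < k ^ 2 × Class c x
  inhabited zero             = 1 , <-trans 1<k k<k^2 , z<s , 1<k
    where
    1<k : 1 < k
    1<k = <-≤-trans (s≤s (s≤s z≤n)) k≥3
  inhabited (suc zero)       = k , k<k^2 , ≤-refl , subst (_< h) (sym (n%n≡0 k)) h>0
  inhabited (suc (suc zero)) = 0 , <-trans (<-trans h>0 h<k) k<k^2 , inj₁ refl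

  -- No class contains a progression

  module _ (P : CyclicAP (k ^ 2) k) where
    open CyclicAP P using (start; distinct; element) renaming (diff to d)

    private
      a : ℕ
      a = toℕ start
      value : Fin k → ℕ
      value i = toℕ (element i)

    value-injective : Injective _≡_ _≡_ value
    value-injective = distinct ∘ toℕ-injective

    value-% : ∀ i → value i % k ≡ (a + toℕ i * d) % k
    value-% i = trans (cong (_% k) (toℕ-fromℕ< _))
      -- Reduction mod `k ^ 2` keeps residues mod `k`, since `k ^ 2` unfolds to `k * (k * 1)`.
      (m∣n⇒o%n%m≡o%m k (k ^ 2) (a + toℕ i * d) {{k≢0}} {{nonZeroIndex start}} (m∣m*n (k * 1)))

    index : ℕ → Fin k
    index n = fromℕ< (m%n<n n k)

    index-% : ∀ n → value (index n) % k ≡ (a + n * d) % k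
    index-% n = trans (value-% (index n))
      (trans (cong (λ i → (a + i * d) % k) (toℕ-fromℕ< (m%n<n n k))) (%-index a n d))

    -- All values share the residue of `a`, so they are told apart by their quotients, which would
    -- lie in `{1, …, k - 1}`.
    not-all-≥k : d % k ≡ 0 → ¬ (∀ i → k ≤ value i)
    not-all-≥k d%k≡0 ≥k = no-injection (λ i → value i / k)
      (λ i → m≥n⇒m/n>0 (≥k i))
      (λ i → m<n*o⇒m/o<n (<-≤-trans (toℕ<n (element i)) (≤-reflexive k^2≡k*k)))
      (λ {i} {j} eq → value-injective (begin
        value i                          ≡⟨ m≡m%n+[m/n]*n (value i) k ⟩
        value i % k + value i / k * k    ≡⟨ cong₂ (λ r q → r + q * k) (trans (constant i) (sym (constant j))) eq ⟩
        value j % k + value j / k * k    ≡⟨ m≡m%n+[m/n]*n (value j) k ⟨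
        value j                          ∎))
      where
      open ≡-Reasoning
      constant : ∀ i → value i % k ≡ a % k
      constant i = begin
        value i % k                          ≡⟨ value-% i ⟩
        (a + toℕ i * d) % k                  ≡⟨ cong (λ z → (a + toℕ i * z) % k) (m≡m%n+[m/n]*n d k) ⟩
        (a + toℕ i * (d % k + d / k * k)) % k ≡⟨ cong (λ r → (a + toℕ i * (r + d / k * k)) % k) d%k≡0 ⟩
        (a + toℕ i * (d / k * k)) % k        ≡⟨ cong (λ z → (a + z) % k) (*-assoc (toℕ i) (d / k) k) ⟨
        (a + toℕ i * (d / k) * k) % k        ≡⟨ [m+kn]%n≡m%n a (toℕ i * (d / k)) k ⟩
        a % k                                ∎

    -- The bound `f` fits both intervals: it equals `k - h`, and it is at most `h`.
    small-step : 0 < d % k → ∃ λ m → 0 < (m * d) % k × (m * d) % k ≤ f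
    small-step d>0 with d % k ≤? f
    ... | yes d≤f = 1 , subst (λ e → 0 < e % k × e % k ≤ f) (sym (*-identityˡ d)) (d>0 , d≤f)
    ... | no d≰f  = pred k , s>0 , s≤f
      where
      s : ℕ
      s = (pred k * d) % k
      s+d≡k : s + d % k ≡ k
      s+d≡k = opposite-residue d d>0
      s>0 : 0 < s
      -- Otherwise `d % k` would be `k`.
      s>0 = n≢0⇒n>0 λ s≡0 → <⇒≢ (m%n<n d k) (trans (cong (_+ d % k) (sym s≡0)) s+d≡k)
      s≤f : s ≤ f
      s≤f = +-cancelʳ-≤ h s f (begin
        s + h       ≤⟨ +-monoʳ-≤ s (≤-trans h≤1+f (≰⇒> d≰f)) ⟩
        s + d % k   ≡⟨ trans s+d≡k (sym f+h≡k) ⟩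
        f + h       ∎)
        where open ≤-Reasoning

    -- Visiting every `m`-th index, cyclically, turns the difference `d` into `m * d` without
    -- leaving the progression.
    index-multiple : ∀ m n → value (index (n * m)) % k ≡ (a + n * (m * d)) % k
    index-multiple m n = trans (index-% (n * m)) (cong (λ z → (a + z) % k) (*-assoc n m d))

    not-all-lower : 0 < d % k → ¬ (∀ i → value i % k < h)
    not-all-lower d>0 <h with small-step d>0
    ... | m , s>0 , s≤f = ap-meets-upper a (m * d) s>0
      (≤-trans (+-monoˡ-≤ h s≤f) (≤-reflexive f+h≡k))
      (λ n → subst (_< h) (index-multiple m n) (<h (index (n * m))))

    not-all-upper : 0 < d % k → ¬ (∀ i → h ≤ value i % k)
    not-all-upper d>0 h≤ with small-step d>0
    ... | m , s>0 , s≤f = ap-meets-lower a (m * d) s>0 (≤-trans s≤f f≤h)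
      (λ n → subst (h ≤_) (index-multiple m n) (h≤ (index (n * m))))

    -- Counted from `j`, the term `c` places on has residue `c * d`. Taking `c` as 1 and `k - 1`
    -- squeezes `d % k` between `h` and `f`; then `c = 2` gives residue 0.
    through-0 : ∀ j → value j ≡ 0 → ¬ (∀ i → ¬ i ≡ j → h ≤ value i % k)
    through-0 j vj≡0 others = <⇒≱ h>0 (≤-trans h≤2d (≤-reflexive (begin
      (2 * d) % k             ≡⟨ cong (λ z → (d + z) % k) (+-identityʳ d) ⟩
      (d + d) % k             ≡⟨ %-distribˡ-+ d d k ⟩
      -- The two copies are rewritten differently so that their sum becomes `k`.
      (d % k + d % k) % k     ≡⟨ cong₂ (λ x y → (x + y) % k) d≡f d≡h ⟩
      (f + h) % k             ≡⟨ cong (_% k) f+h≡k ⟩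
      k % k                   ≡⟨ n%n≡0 k ⟩
      0                       ∎)))
      where
      open ≡-Reasoning
      multiple : ∀ c → value (index (toℕ j + c)) % k ≡ (c * d) % k
      multiple c = begin
        value (index (toℕ j + c)) % k                   ≡⟨ index-% (toℕ j + c) ⟩
        (a + (toℕ j + c) * d) % k                       ≡⟨ cong (λ z → (a + z) % k) (*-distribʳ-+ d (toℕ j) c) ⟩
        (a + (toℕ j * d + c * d)) % k                   ≡⟨ cong (_% k) (+-assoc a (toℕ j * d) (c * d)) ⟨
        (a + toℕ j * d + c * d) % k                     ≡⟨ %-distribˡ-+ (a + toℕ j * d) (c * d) k ⟩
        ((a + toℕ j * d) % k + (c * d) % k) % k         ≡⟨ cong (λ z → (z + (c * d) % k) % k) (value-% j) ⟨
        (value j % k + (c * d) % k) % k                 ≡⟨ cong (λ z → (z % k + (c * d) % k) % k) vj≡0 ⟩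
        (0 % k + (c * d) % k) % k                       ≡⟨ %-distribˡ-+ 0 (c * d) k ⟨
        (c * d) % k                                     ∎
      h≤multiple : ∀ c → 0 < c → c < k → h ≤ (c * d) % k
      h≤multiple c c>0 c<k = subst (h ≤_) (multiple c) (others (index (toℕ j + c))
        λ eq → shifted-index (toℕ<n j) c>0 c<k (trans (sym (toℕ-fromℕ< _)) (cong toℕ eq)))
      h≤d : h ≤ d % k
      h≤d = subst (λ e → h ≤ e % k) (*-identityˡ d) (h≤multiple 1 z<s (<-≤-trans (s≤s (s≤s z≤n)) k≥3))
      h≤2d : h ≤ (2 * d) % k
      -- Here `k≥3` is read as `2 < k`: the term two places on is not the one at `j`.
      h≤2d = h≤multiple 2 z<s k≥3
      h≤-d : h ≤ (pred k * d) % k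
      h≤-d = h≤multiple (pred k) (≤-trans (s≤s z≤n) (pred-mono-≤ k≥3)) (≤-reflexive (suc-pred k))
      d≤f : d % k ≤ f
      d≤f = +-cancelˡ-≤ h (d % k) f (≤-trans (+-monoˡ-≤ (d % k) h≤-d) (≤-reflexive
        (trans (opposite-residue d (<-≤-trans h>0 h≤d)) (trans (sym f+h≡k) (+-comm f h)))))
      d≡f : d % k ≡ f
      d≡f = ≤-antisym d≤f (≤-trans f≤h h≤d)
      d≡h : d % k ≡ h
      d≡h = ≤-antisym (≤-trans d≤f f≤h) h≤d

    free : ∀ c → ¬ (∀ i → Class c (value i))
    free zero mem = no-injection value (proj₁ ∘ mem) (proj₂ ∘ mem) value-injective
    free (suc zero) mem with d % k in eq
    ... | zero  = not-all-≥k eq (proj₁ ∘ mem)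
    ... | suc _ = not-all-lower (subst (0 <_) (sym eq) z<s) (proj₂ ∘ mem)
    free (suc (suc zero)) mem with any? (λ i → value i ℕ≟ 0)
    ... | yes (j , vj≡0) = through-0 j vj≡0 upper
      where
      upper : ∀ i → ¬ i ≡ j → h ≤ value i % k
      upper i i≢j with mem i
      ... | inj₁ vi≡0     = contradiction (value-injective (trans vi≡0 (sym vj≡0))) i≢j
      ... | inj₂ (_ , h≤) = h≤
    ... | no none = absurd
      where
      nonzero : ∀ i → k ≤ value i × h ≤ value i % k
      nonzero i with mem i
      ... | inj₁ vi≡0 = contradiction (i , vi≡0) none
      ... | inj₂ q    = q
      absurd : ⊥
      absurd with d % k in eq
      ... | zero  = not-all-≥k eq (proj₁ ∘ nonzero)
      ... | suc _ = not-all-upper (subst (0 <_) (sym eq) z<s) (proj₂ ∘ nonzero)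

  -- The upper and lower bounds

  threeParts : APFreePartition (k ^ 2) k 3
  threeParts = classesPartition (λ c x → Class c (toℕ x)) (classify ∘ toℕ)
    (λ {c} {c′} → unique {c} {c′})
    (λ c → let x , x<N , cl = inhabited c
           in fromℕ< x<N , subst (Class c) (sym (toℕ-fromℕ< x<N)) cl)
    (λ c P → free P c)

  origin : Fin (k ^ 2)
  origin = fromℕ< (<-trans (<-trans h>0 h<k) k<k^2)

  -- The progression `0, 1, …, k - 1` stays below `k ^ 2`, so reduction leaves it unchanged; a
  -- single part would contain it.
  interval : CyclicAP (k ^ 2) k
  interval = record
    { start = origin ; diff = 1 ; diff>0 = z<s
    ; distinct = λ {i} {j} eq → toℕ-injective (trans (sym (value i)) (trans (cong toℕ eq) (value j))) }
    where
    value : ∀ i → toℕ (term origin 1 (toℕ i)) ≡ toℕ i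
    value i = begin
      toℕ (term origin 1 (toℕ i))           ≡⟨ toℕ-fromℕ< _ ⟩
      (toℕ origin + toℕ i * 1) % k ^ 2      ≡⟨ cong₂ (λ x y → (x + y) % k ^ 2) (toℕ-fromℕ< _) (*-identityʳ (toℕ i)) ⟩
      toℕ i % k ^ 2                         ≡⟨ m<n⇒m%n≡m (<-trans (toℕ<n i) k<k^2) ⟩
      toℕ i                                 ∎
      where
      open ≡-Reasoning
      instance
        _ : NonZero (k ^ 2)
        _ = nonZeroIndex origin

  atLeastTwoParts : ∀ m → APFreePartition (k ^ 2) k m → 2 ≤ m
  atLeastTwoParts zero (_ , partition , _) with IsPartition.cover partition origin
  ... | () , _
  atLeastTwoParts (suc zero) (parts , partition , free′) =
    contradiction (interval , λ i → whole (CyclicAP.element interval i)) (free′ zero)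
    where
    whole : ∀ x → x ∈ lookup parts zero
    whole x with IsPartition.cover partition x
    ... | zero , x∈ = x∈
  atLeastTwoParts (suc (suc _)) _ = s≤s (s≤s z≤n)

proposition4p3 : (k : ℕ) (k≥3 : 3 ≤ k) → 2 ≤ χ (k ^ 2) k k≥3 × χ (k ^ 2) k k≥3 ≤ 3
proposition4p3 k k≥3 =
  let admissible , minimal = χ-isLeast (k ^ 2) k k≥3
      open SquareModulus k k≥3
  in atLeastTwoParts _ admissible , minimal 3 threeParts
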